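{- Let $p>q>1$ be relatively prime integers and let $\epsilon>0$. Then there exists a finite union of intervals $K\subseteq[0,1)$ of total length at least $1-\epsilon$ such that $Z_{p/q}(K)=\emptyset$.
   Context: For $x\in\mathbb{R}$, $\{x\}=x-\lfloor x\rfloor$ denotes the fractional part. For relatively prime integers $p>q>1$ and $S\subseteq[0,1)$, $Z_{p/q}(S)=\{\xi>0 \mid \{\xi (p/q)^i\}\in S \text{ for every } i\in\mathbb{N}\}$, where $\mathbb{N}=\{0,1,2,\dots\}$. -}

module Defs where

open import Level using (0ℓ)
open import Data.Bool using (Bool; true; false)
open import Data.Nat as ℕ using (ℕ; zero; suc; _⊔_)
import Data.Nat.Properties as ℕ
open import Data.Integer as ℤ using (ℤ; +_)
open import Data.List using (List; []; _∷_)
open import Data.List.Relation.Unary.Any using (Any)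
open import Data.List.Relation.Unary.AllPairs using (AllPairs)
open import Data.Product using (Σ; ∃; _×_; _,_)
open import Data.Rational as ℚ using (ℚ; 0ℚ; 1ℚ; ½; Positive)
import Data.Rational.Properties as ℚ
open import Data.Rational.Solver using (module +-*-Solver)
open import Relation.Binary.PropositionalEquality using (_≡_; refl; sym; trans; cong; cong₂; subst)
open import Relation.Nullary using (¬_)
open import Relation.Unary using (Pred; _∈_)

-- Real numbers as Cauchy sequences of rationals. Two sequences denote the
-- same real when neither is strictly smaller than the other (_<_ below).

IsCauchy : (ℕ → ℚ) → Set
IsCauchy s = ∀ δ → 0ℚ ℚ.< δ →
  ∃ λ N → ∀ m n → N ℕ.≤ m → N ℕ.≤ n → ℚ.∣ s m ℚ.- s n ∣ ℚ.< δ

record ℝ : Set where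
  constructor mkℝ
  field
    seq    : ℕ → ℚ
    cauchy : IsCauchy seq

open ℝ public

private
  ⊔≤ˡ : ∀ m n k → m ⊔ n ℕ.≤ k → m ℕ.≤ k
  ⊔≤ˡ m n _ = ℕ.≤-trans (ℕ.m≤m⊔n m n)

  ⊔≤ʳ : ∀ m n k → m ⊔ n ℕ.≤ k → n ℕ.≤ k
  ⊔≤ʳ m n _ = ℕ.≤-trans (ℕ.m≤n⊔m m n)

  halves : ∀ δ → ½ ℚ.* δ ℚ.+ ½ ℚ.* δ ≡ δ
  halves δ = trans (sym (ℚ.*-distribʳ-+ δ ½ ½)) (ℚ.*-identityˡ δ)

  half>0 : ∀ {δ} → 0ℚ ℚ.< δ → 0ℚ ℚ.< ½ ℚ.* δ
  half>0 {δ} δ>0 = ℚ.positive⁻¹ (½ ℚ.* δ) {{ℚ.pos*pos⇒pos ½ δ {{ℚ.positive δ>0}}}}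

  const-cauchy : ∀ r → IsCauchy (λ _ → r)
  const-cauchy r δ δ>0 = 0 , λ _ _ _ _ →
    subst (λ t → ℚ.∣ t ∣ ℚ.< δ) (sym (ℚ.+-inverseʳ r)) δ>0

  +-cauchy : ∀ {s t} → IsCauchy s → IsCauchy t → IsCauchy (λ n → s n ℚ.+ t n)
  +-cauchy {s} {t} cs ct δ δ>0 with cs (½ ℚ.* δ) (half>0 δ>0) | ct (½ ℚ.* δ) (half>0 δ>0)
  ... | M , hM | N , hN = M ⊔ N , λ m n m≥ n≥ → begin-strict
      ℚ.∣ (s m ℚ.+ t m) ℚ.- (s n ℚ.+ t n) ∣
        ≡⟨ cong ℚ.∣_∣ (rearrange (s m) (t m) (s n) (t n)) ⟩
      ℚ.∣ (s m ℚ.- s n) ℚ.+ (t m ℚ.- t n) ∣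
        ≤⟨ ℚ.∣p+q∣≤∣p∣+∣q∣ (s m ℚ.- s n) (t m ℚ.- t n) ⟩
      ℚ.∣ s m ℚ.- s n ∣ ℚ.+ ℚ.∣ t m ℚ.- t n ∣
        <⟨ ℚ.+-mono-< (hM m n (⊔≤ˡ M N m m≥) (⊔≤ˡ M N n n≥))
                      (hN m n (⊔≤ʳ M N m m≥) (⊔≤ʳ M N n n≥)) ⟩
      ½ ℚ.* δ ℚ.+ ½ ℚ.* δ
        ≡⟨ halves δ ⟩
      δ ∎
    where
    open ℚ.≤-Reasoning
    rearrange : ∀ a b c d → (a ℚ.+ b) ℚ.- (c ℚ.+ d) ≡ (a ℚ.- c) ℚ.+ (b ℚ.- d)
    rearrange = solve 4 (λ a b c d → (a :+ b) :- (c :+ d) := (a :- c) :+ (b :- d)) refl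
      where open +-*-Solver

  neg-cauchy : ∀ {s} → IsCauchy s → IsCauchy (λ n → ℚ.- s n)
  neg-cauchy {s} cs δ δ>0 with cs δ δ>0
  ... | N , h = N , λ m n m≥ n≥ →
      subst (ℚ._< δ) (trans (sym (ℚ.∣-p∣≡∣p∣ (s m ℚ.- s n))) (cong ℚ.∣_∣ (rearrange (s m) (s n))))
        (h m n m≥ n≥)
    where
    rearrange : ∀ a b → ℚ.- (a ℚ.- b) ≡ (ℚ.- a) ℚ.- (ℚ.- b)
    rearrange = solve 2 (λ a b → :- (a :- b) := (:- a) :- (:- b)) refl
      where open +-*-Solver

  bound : ∀ {s} → IsCauchy s →
    Σ ℚ λ B → Positive B × ∃ λ N → ∀ n → N ℕ.≤ n → ℚ.∣ s n ∣ ℚ.≤ B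
  bound {s} cs with cs 1ℚ (ℚ.positive⁻¹ 1ℚ)
  ... | N , h = 1ℚ ℚ.+ ℚ.∣ s N ∣ ,
      ℚ.positive (ℚ.+-mono-<-≤ (ℚ.positive⁻¹ 1ℚ) (ℚ.0≤∣p∣ (s N))) ,
      N , λ n n≥ → begin
        ℚ.∣ s n ∣                          ≡⟨ cong ℚ.∣_∣ (rearrange (s n) (s N)) ⟩
        ℚ.∣ (s n ℚ.- s N) ℚ.+ s N ∣        ≤⟨ ℚ.∣p+q∣≤∣p∣+∣q∣ (s n ℚ.- s N) (s N) ⟩
        ℚ.∣ s n ℚ.- s N ∣ ℚ.+ ℚ.∣ s N ∣    ≤⟨ ℚ.+-monoˡ-≤ ℚ.∣ s N ∣ (ℚ.<⇒≤ (h n N n≥ ℕ.≤-refl)) ⟩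
        1ℚ ℚ.+ ℚ.∣ s N ∣                   ∎
    where
    open ℚ.≤-Reasoning
    rearrange : ∀ a b → a ≡ (a ℚ.- b) ℚ.+ b
    rearrange = solve 2 (λ a b → a := (a :- b) :+ b) refl
      where open +-*-Solver

  quotient : ∀ B → Positive B → ∀ δ → 0ℚ ℚ.< δ → Σ ℚ λ η → 0ℚ ℚ.< η × B ℚ.* η ≡ δ
  quotient B B>0 δ δ>0 = B⁻¹ ℚ.* δ ,
      ℚ.positive⁻¹ (B⁻¹ ℚ.* δ) {{ℚ.pos*pos⇒pos B⁻¹ {{ℚ.1/pos⇒pos B {{B>0}}}} δ {{ℚ.positive δ>0}}}} ,
      trans (sym (ℚ.*-assoc B B⁻¹ δ))
        (trans (cong (ℚ._* δ) (ℚ.*-inverseʳ B {{nz}})) (ℚ.*-identityˡ δ))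
    where
    nz : ℚ.NonZero B
    nz = ℚ.pos⇒nonZero B {{B>0}}
    B⁻¹ : ℚ
    B⁻¹ = ℚ.1/_ B {{nz}}

  *-bound : ∀ a b {B η} → Positive B → ℚ.∣ a ∣ ℚ.≤ B → ℚ.∣ b ∣ ℚ.< η → ℚ.∣ a ℚ.* b ∣ ℚ.< B ℚ.* η
  *-bound a b {B} {η} B>0 a≤ b< = begin-strict
    ℚ.∣ a ℚ.* b ∣          ≡⟨ ℚ.∣p*q∣≡∣p∣*∣q∣ a b ⟩
    ℚ.∣ a ∣ ℚ.* ℚ.∣ b ∣    ≤⟨ ℚ.*-monoʳ-≤-nonNeg ℚ.∣ b ∣ {{ℚ.∣-∣-nonNeg b}} a≤ ⟩
    B ℚ.* ℚ.∣ b ∣          <⟨ ℚ.*-monoʳ-<-pos B {{B>0}} b< ⟩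
    B ℚ.* η                ∎
    where open ℚ.≤-Reasoning

  *-step : ∀ a b c d {B C η θ δ} → Positive B → Positive C →
    B ℚ.* η ≡ ½ ℚ.* δ → C ℚ.* θ ≡ ½ ℚ.* δ →
    ℚ.∣ a ∣ ℚ.≤ B → ℚ.∣ b ℚ.- d ∣ ℚ.< η → ℚ.∣ d ∣ ℚ.≤ C → ℚ.∣ a ℚ.- c ∣ ℚ.< θ →
    ℚ.∣ a ℚ.* b ℚ.- c ℚ.* d ∣ ℚ.< δ
  *-step a b c d {B} {C} {η} {θ} {δ} B>0 C>0 Bη≡ Cθ≡ a≤ b-d< d≤ a-c< = begin-strict
      ℚ.∣ a ℚ.* b ℚ.- c ℚ.* d ∣
        ≡⟨ cong ℚ.∣_∣ (rearrange a b c d) ⟩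
      ℚ.∣ a ℚ.* (b ℚ.- d) ℚ.+ d ℚ.* (a ℚ.- c) ∣
        ≤⟨ ℚ.∣p+q∣≤∣p∣+∣q∣ (a ℚ.* (b ℚ.- d)) (d ℚ.* (a ℚ.- c)) ⟩
      ℚ.∣ a ℚ.* (b ℚ.- d) ∣ ℚ.+ ℚ.∣ d ℚ.* (a ℚ.- c) ∣
        <⟨ ℚ.+-mono-< (*-bound a (b ℚ.- d) B>0 a≤ b-d<) (*-bound d (a ℚ.- c) C>0 d≤ a-c<) ⟩
      B ℚ.* η ℚ.+ C ℚ.* θ
        ≡⟨ cong₂ ℚ._+_ Bη≡ Cθ≡ ⟩
      ½ ℚ.* δ ℚ.+ ½ ℚ.* δ
        ≡⟨ halves δ ⟩
      δ ∎
    where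
    open ℚ.≤-Reasoning
    rearrange : ∀ a b c d → a ℚ.* b ℚ.- c ℚ.* d ≡ a ℚ.* (b ℚ.- d) ℚ.+ d ℚ.* (a ℚ.- c)
    rearrange = solve 4 (λ a b c d → a :* b :- c :* d := a :* (b :- d) :+ d :* (a :- c)) refl
      where open +-*-Solver

  *-cauchy : ∀ {s t} → IsCauchy s → IsCauchy t → IsCauchy (λ n → s n ℚ.* t n)
  *-cauchy {s} {t} cs ct δ δ>0 =
    let B , B>0 , K , hK = bound {s} cs
        C , C>0 , L , hL = bound {t} ct
        η , η>0 , Bη≡    = quotient B B>0 (½ ℚ.* δ) (half>0 δ>0)
        θ , θ>0 , Cθ≡    = quotient C C>0 (½ ℚ.* δ) (half>0 δ>0)
        M , hM           = ct η η>0
        N , hN           = cs θ θ>0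
        KL≤ = λ k k≥ → ⊔≤ˡ (K ⊔ L) (M ⊔ N) k k≥
        MN≤ = λ k k≥ → ⊔≤ʳ (K ⊔ L) (M ⊔ N) k k≥
        M≤  = λ k k≥ → ⊔≤ˡ M N k (MN≤ k k≥)
        N≤  = λ k k≥ → ⊔≤ʳ M N k (MN≤ k k≥)
    in (K ⊔ L) ⊔ (M ⊔ N) , λ m n m≥ n≥ →
      *-step (s m) (t m) (s n) (t n) B>0 C>0 Bη≡ Cθ≡
        (hK m (⊔≤ˡ K L m (KL≤ m m≥))) (hM m n (M≤ m m≥) (M≤ n n≥))
        (hL n (⊔≤ʳ K L n (KL≤ n n≥))) (hN m n (N≤ m m≥) (N≤ n n≥))

infixl 6 _+_ _-_
infixl 7 _*_
infixr 8 _^_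
infix  4 _<_ _≤_

fromℚ : ℚ → ℝ
fromℚ r = mkℝ (λ _ → r) (const-cauchy r)

fromℤ : ℤ → ℝ
fromℤ n = fromℚ (n ℚ./ 1)

0ℝ 1ℝ : ℝ
0ℝ = fromℚ 0ℚ
1ℝ = fromℚ 1ℚ

_+_ _-_ _*_ : ℝ → ℝ → ℝ
x + y = mkℝ (λ n → seq x n ℚ.+ seq y n) (+-cauchy {seq x} {seq y} (cauchy x) (cauchy y))
x - y = mkℝ (λ n → seq x n ℚ.- seq y n)
  (+-cauchy {seq x} {λ n → ℚ.- seq y n} (cauchy x) (neg-cauchy {seq y} (cauchy y)))
x * y = mkℝ (λ n → seq x n ℚ.* seq y n) (*-cauchy {seq x} {seq y} (cauchy x) (cauchy y))

_^_ : ℝ → ℕ → ℝ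
x ^ zero  = 1ℝ
x ^ suc i = x * x ^ i

_<_ : ℝ → ℝ → Set
x < y = Σ ℚ λ δ → 0ℚ ℚ.< δ × ∃ λ N → ∀ n → N ℕ.≤ n → seq x n ℚ.+ δ ℚ.≤ seq y n

_≤_ : ℝ → ℝ → Set
x ≤ y = ¬ (y < x)

-- An end belongs to the interval exactly when its flag is true.
record Interval : Set where
  field
    lo hi               : ℝ
    lo≤hi               : lo ≤ hi
    lo-closed hi-closed : Bool

open Interval public

_≤[_]_ : ℝ → Bool → ℝ → Set
x ≤[ true  ] y = x ≤ y
x ≤[ false ] y = x < y

⟦_⟧ : Interval → Pred ℝ 0ℓ
⟦ I ⟧ x = lo I ≤[ lo-closed I ] x × x ≤[ hi-closed I ] hi I

⋃ : List Interval → Pred ℝ 0ℓ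
⋃ Is x = Any (λ I → x ∈ ⟦ I ⟧) Is

PairwiseDisjoint : List Interval → Set
PairwiseDisjoint = AllPairs (λ I J → ∀ x → ¬ (x ∈ ⟦ I ⟧ × x ∈ ⟦ J ⟧))

length : Interval → ℝ
length I = hi I - lo I

-- This is the total length (Lebesgue measure) of ⋃ Is only when the list is
-- pairwise disjoint.
totalLength : List Interval → ℝ
totalLength []       = 0ℝ
totalLength (I ∷ Is) = length I + totalLength Is

[0,1⟩ : Pred ℝ 0ℓ
[0,1⟩ x = 0ℝ ≤ x × x < 1ℝ

IsFloor : ℝ → ℤ → Set
IsFloor x n = fromℤ n ≤ x × x < fromℤ n + 1ℝ

-- FracIn S x expresses {x} ∈ S. There is no constructive floor function on ℝ,
-- so ⌊x⌋ enters as the (unique) integer n with n ≤ x < n + 1.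
FracIn : Pred ℝ 0ℓ → Pred ℝ 0ℓ
FracIn S x = ∃ λ n → IsFloor x n × x - fromℤ n ∈ S

Z : (p q : ℕ) .{{_ : ℕ.NonZero q}} → Pred ℝ 0ℓ → Pred ℝ 0ℓ
Z p q S ξ = 0ℝ < ξ × (∀ i → FracIn S (ξ * fromℚ (+ p ℚ./ q) ^ i))

{-# OPTIONS --safe #-}

-- Put P = pᶜ, Q = qᶜ with 1/Q small, and let xᵢ = ξ(p/q)ⁱ. Say that a real x
-- is hit at level j ≤ N when ⌊Q^(N+1-j) P^j x⌋ is divisible by Q. Since
-- x_{cj} = x₀(P/Q)^j, the orbit point x_{cj} is hit at level 0 exactly when x₀
-- is hit at level j. All these conditions depend only on {x}, in fact only on
-- the cell [r/D, (r+1)/D), D = Q^(N+1) P^N, containing {x}. Let K be the union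
-- of the cells not hit at level 0 but hit at some level j ≤ N. If {x₀} ∈ K then
-- some x_{cj} is hit at level 0, so {x_{cj}} ∉ K, and no orbit stays in K. The
-- complement of K consists of the cells hit at level 0 (proportion 1/Q) and of
-- those hit at no level; as P is invertible modulo Q, the levels behave like
-- independent base-Q digits, so the latter have proportion (1-1/Q)^(N+1).

module Submission where

module Arithmetic where

  open import Data.Bool using (Bool; true; false; T; not; _∧_; _∨_; if_then_else_)
  open import Data.Nat
  open import Data.Nat.Properties
  open import Data.Nat.Coprimality as Coprimality using (Coprime; coprime-divisor; coprime-Bézout)
  open import Data.Nat.Divisibility
  open import Data.Nat.DivMod
  open import Data.Nat.GCD using (module Bézout)
  open import Data.Nat.Solver using (module +-*-Solver)
  open import Data.Product using (∃; _×_; _,_)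
  open import Data.Sum using (inj₁; inj₂)
  open import Relation.Binary.Definitions using (tri<; tri≈; tri>)
  open import Relation.Binary.PropositionalEquality
  open import Relation.Nullary using (¬_; does; contradiction)
  open import Relation.Nullary.Decidable using (dec-true; dec-false; does-⇔)
  open import Function.Bundles using (mk⇔)

  -- Finite sums over initial segments of the naturals.

  ∑ : ℕ → (ℕ → ℕ) → ℕ
  ∑ zero    f = 0
  ∑ (suc n) f = ∑ n f + f n

  ∑-cong : ∀ n {f g} → (∀ i → i < n → f i ≡ g i) → ∑ n f ≡ ∑ n g
  ∑-cong zero    h = refl
  ∑-cong (suc n) h = cong₂ _+_ (∑-cong n λ i i<n → h i (m<n⇒m<1+n i<n)) (h n ≤-refl)

  ∑-mono : ∀ n {f g} → (∀ i → i < n → f i ≤ g i) → ∑ n f ≤ ∑ n g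
  ∑-mono zero    h = z≤n
  ∑-mono (suc n) h = +-mono-≤ (∑-mono n λ i i<n → h i (m<n⇒m<1+n i<n)) (h n ≤-refl)

  ∑-const : ∀ n c → ∑ n (λ _ → c) ≡ n * c
  ∑-const zero    c = refl
  ∑-const (suc n) c = trans (cong (_+ c) (∑-const n c)) (+-comm (n * c) c)

  ∑-*ˡ : ∀ n c f → ∑ n (λ i → c * f i) ≡ c * ∑ n f
  ∑-*ˡ zero    c f = sym (*-zeroʳ c)
  ∑-*ˡ (suc n) c f = trans (cong (_+ c * f n) (∑-*ˡ n c f)) (sym (*-distribˡ-+ c (∑ n f) (f n)))

  ∑-*ʳ : ∀ n c f → ∑ n (λ i → f i * c) ≡ ∑ n f * c
  ∑-*ʳ zero    c f = refl
  ∑-*ʳ (suc n) c f = trans (cong (_+ f n * c) (∑-*ʳ n c f)) (sym (*-distribʳ-+ c (∑ n f) (f n)))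

  ∑-distrib-+ : ∀ n f g → ∑ n (λ i → f i + g i) ≡ ∑ n f + ∑ n g
  ∑-distrib-+ zero    f g = refl
  ∑-distrib-+ (suc n) f g = trans (cong (_+ (f n + g n)) (∑-distrib-+ n f g))
    (solve 4 (λ a b c d → (a :+ b) :+ (c :+ d) := (a :+ c) :+ (b :+ d)) refl (∑ n f) (∑ n g) (f n) (g n))
    where open +-*-Solver

  ∑-swap : ∀ m n (f : ℕ → ℕ → ℕ) → ∑ m (λ i → ∑ n (f i)) ≡ ∑ n (λ j → ∑ m (λ i → f i j))
  ∑-swap zero    n f = sym (trans (∑-const n 0) (*-zeroʳ n))
  ∑-swap (suc m) n f = trans (cong (_+ ∑ n (f m)) (∑-swap m n f))
    (sym (∑-distrib-+ n (λ j → ∑ m (λ i → f i j)) (f m)))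

  ∑-split : ∀ m n f → ∑ (m + n) f ≡ ∑ m f + ∑ n (λ i → f (m + i))
  ∑-split m zero    f rewrite +-identityʳ m = sym (+-identityʳ (∑ m f))
  ∑-split m (suc n) f rewrite +-suc m n | ∑-split m n f = +-assoc (∑ m f) _ _

  -- Division with remainder of the index by `n`. In the counts below, `d` is the leading digit of a
  -- cell index and `r` the rest.
  ∑-blocks : ∀ m n f → ∑ (m * n) f ≡ ∑ m (λ d → ∑ n (λ r → f (d * n + r)))
  ∑-blocks zero    n f = refl
  ∑-blocks (suc m) n f rewrite +-comm n (m * n) =
    trans (∑-split (m * n) n f) (cong (_+ ∑ n (λ r → f (m * n + r))) (∑-blocks m n f))

  -- Counting with indicator functions.

  𝟙 : Bool → ℕ
  𝟙 b = if b then 1 else 0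

  𝟙≤1 : ∀ b → 𝟙 b ≤ 1
  𝟙≤1 true  = ≤-refl
  𝟙≤1 false = z≤n

  𝟙-∧ : ∀ a b → 𝟙 (a ∧ b) ≡ 𝟙 a * 𝟙 b
  𝟙-∧ true  b = sym (+-identityʳ (𝟙 b))
  𝟙-∧ false b = refl

  𝟙-∨ : ∀ a b → 𝟙 (a ∨ b) ≤ 𝟙 a + 𝟙 b
  𝟙-∨ true  b = m≤m+n 1 (𝟙 b)
  𝟙-∨ false b = ≤-refl

  𝟙-not : ∀ b → 𝟙 (not b) + 𝟙 b ≡ 1
  𝟙-not true  = refl
  𝟙-not false = refl

  count-not : ∀ n (b : ℕ → Bool) → ∑ n (λ i → 𝟙 (not (b i))) + ∑ n (λ i → 𝟙 (b i)) ≡ n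
  count-not n b = begin
    ∑ n (λ i → 𝟙 (not (b i))) + ∑ n (λ i → 𝟙 (b i))  ≡⟨ ∑-distrib-+ n _ _ ⟨
    ∑ n (λ i → 𝟙 (not (b i)) + 𝟙 (b i))              ≡⟨ ∑-cong n (λ i _ → 𝟙-not (b i)) ⟩
    ∑ n (λ _ → 1)                                    ≡⟨ ∑-const n 1 ⟩
    n * 1                                            ≡⟨ *-identityʳ n ⟩
    n                                                ∎
    where open ≡-Reasoning

  count≤ : ∀ n (b : ℕ → Bool) → ∑ n (λ i → 𝟙 (b i)) ≤ n
  count≤ n b = subst (∑ n (λ i → 𝟙 (b i)) ≤_) (count-not n b) (m≤n+m _ _)

  1≤count : ∀ {n i} (b : ℕ → Bool) → i < n → b i ≡ true → 1 ≤ ∑ n (λ j → 𝟙 (b j))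
  1≤count {suc n} b i<1+n bi with m<1+n⇒m<n∨m≡n i<1+n
  ... | inj₁ i<n  = ≤-trans (1≤count b i<n bi) (m≤m+n _ _)
  ... | inj₂ refl = ≤-trans (≤-reflexive (sym (cong 𝟙 bi))) (m≤n+m (𝟙 (b n)) _)

  count-not< : ∀ {n i} (b : ℕ → Bool) → i < n → b i ≡ true → ∑ n (λ j → 𝟙 (not (b j))) ≤ pred n
  count-not< {n} b i<n bi = begin
    ∑ n (λ j → 𝟙 (not (b j)))  ≤⟨ pred-mono-≤ (≤-trans (≤-reflexive (+-comm 1 _)) (+-monoʳ-≤ _ (1≤count b i<n bi))) ⟩
    pred (∑ n (λ j → 𝟙 (not (b j))) + ∑ n (λ j → 𝟙 (b j)))  ≡⟨ cong pred (count-not n b) ⟩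
    pred n ∎
    where open ≤-Reasoning

  count-< : ∀ m n → ∑ n (λ r → 𝟙 (r <ᵇ m)) ≤ m
  count-< m zero    = z≤n
  count-< m (suc n) with n <ᵇ m in e
  ... | true  = ≤-trans (≤-reflexive (+-comm _ 1))
                  (≤-trans (s≤s (count≤ n (_<ᵇ m))) (<ᵇ⇒< n m (subst T (sym e) _)))
  ... | false = ≤-trans (≤-reflexive (+-identityʳ _)) (count-< m n)

  -- Coprimality, linear congruences and growth of powers.

  coprime-*ʳ : ∀ {m a b} → Coprime m a → Coprime m b → Coprime m (a * b)
  coprime-*ʳ m⊥a m⊥b (d∣m , d∣ab) =
    m⊥b (d∣m , coprime-divisor (λ (e∣d , e∣a) → m⊥a (∣-trans e∣d d∣m , e∣a)) d∣ab)

  coprime-^ʳ : ∀ {m a} k → Coprime m a → Coprime m (a ^ k)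
  coprime-^ʳ {m} zero    m⊥a = Coprimality.sym (Coprimality.1-coprimeTo m)
  coprime-^ʳ     (suc k) m⊥a = coprime-*ʳ m⊥a (coprime-^ʳ k m⊥a)

  coprime-^ : ∀ {a b} k l → Coprime a b → Coprime (a ^ k) (b ^ l)
  coprime-^ k l a⊥b = coprime-^ʳ l (Coprimality.sym (coprime-^ʳ k (Coprimality.sym a⊥b)))

  -- Solves d P ≡ -a modulo Q without subtraction. If x P = 1 + y Q, then x inverts P and a (Q-1)
  -- stands for -a. If 1 + x P = y Q, then x is already minus an inverse, so x a works.
  bézout⇒linear : ∀ {P Q} .{{_ : NonZero Q}} → Bézout.Identity 1 P Q →
    ∀ a → ∃ λ d → Q ∣ d * P + a
  bézout⇒linear {P} {Q} (Bézout.+- x y eq) a = x * (a * pred Q) , divides (y * (a * pred Q) + a) (begin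
    x * (a * pred Q) * P + a
      ≡⟨ solve 4 (λ x r p a → x :* r :* p :+ a := x :* p :* r :+ a) refl x (a * pred Q) P a ⟩
    x * P * (a * pred Q) + a
      ≡⟨ cong (λ t → t * (a * pred Q) + a) (sym eq) ⟩
    (1 + y * Q) * (a * pred Q) + a
      ≡⟨ solve 4 (λ y q a r → (con 1 :+ y :* q) :* (a :* r) :+ a := y :* (a :* r) :* q :+ a :* (con 1 :+ r))
           refl y Q a (pred Q) ⟩
    y * (a * pred Q) * Q + a * suc (pred Q)
      ≡⟨ cong (λ t → y * (a * pred Q) * Q + a * t) (suc-pred Q) ⟩
    y * (a * pred Q) * Q + a * Q
      ≡⟨ *-distribʳ-+ Q (y * (a * pred Q)) a ⟨
    (y * (a * pred Q) + a) * Q ∎)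
    where open ≡-Reasoning
          open +-*-Solver
  bézout⇒linear {P} {Q} (Bézout.-+ x y eq) a = x * a , divides (y * a) (begin
    x * a * P + a     ≡⟨ solve 3 (λ x a p → x :* a :* p :+ a := (con 1 :+ x :* p) :* a) refl x a P ⟩
    (1 + x * P) * a   ≡⟨ cong (_* a) eq ⟩
    y * Q * a         ≡⟨ solve 3 (λ y q a → y :* q :* a := y :* a :* q) refl y Q a ⟩
    y * a * Q         ∎)
    where open ≡-Reasoning
          open +-*-Solver

  -- Reducing a solution modulo Q changes d P only by a multiple of Q.
  coprime⇒linear : ∀ {P Q} .{{_ : NonZero Q}} → Coprime P Q →
    ∀ a → ∃ λ d → d < Q × Q ∣ d * P + a
  coprime⇒linear {P} {Q} P⊥Q a with e , Q∣ ← bézout⇒linear (coprime-Bézout P⊥Q) a =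
    e % Q , m%n<n e Q ,
    ∣m+n∣m⇒∣n (subst (Q ∣_) (trans (cong (λ t → t * P + a) (m≡m%n+[m/n]*n e Q)) (rearrange (e % Q) (e / Q))) Q∣)
      (n∣m*n ((e / Q) * P))
    where
    open +-*-Solver
    rearrange : ∀ u v → (u + v * Q) * P + a ≡ v * P * Q + (u * P + a)
    rearrange u v = solve 5 (λ u v q p a → (u :+ v :* q) :* p :+ a := v :* p :* q :+ (u :* p :+ a)) refl u v Q P a

  -- Bernoulli's inequality 1 + n/m ≤ (1 + 1/m)^n, multiplied by m^(n+1).
  bernoulli : ∀ m n → (m + n) * m ^ n ≤ m * suc m ^ n
  bernoulli m zero    = ≤-reflexive (cong (_* 1) (+-identityʳ m))
  bernoulli m (suc n) = begin
    (m + suc n) * (m * m ^ n)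
      ≡⟨ solve 3 (λ m n t → (m :+ (con 1 :+ n)) :* (m :* t) := m :* ((m :+ n) :* t) :+ m :* t) refl m n (m ^ n) ⟩
    m * ((m + n) * m ^ n) + m * m ^ n
      ≤⟨ +-monoʳ-≤ (m * ((m + n) * m ^ n)) (*-monoˡ-≤ (m ^ n) (m≤m+n m n)) ⟩
    m * ((m + n) * m ^ n) + (m + n) * m ^ n
      ≡⟨ +-comm (m * ((m + n) * m ^ n)) _ ⟩
    suc m * ((m + n) * m ^ n)
      ≤⟨ *-monoʳ-≤ (suc m) (bernoulli m n) ⟩
    suc m * (m * suc m ^ n)
      ≡⟨ solve 2 (λ m t → (con 1 :+ m) :* (m :* t) := m :* ((con 1 :+ m) :* t)) refl m (suc m ^ n) ⟩
    m * (suc m * suc m ^ n) ∎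
    where open ≤-Reasoning
          open +-*-Solver

  -- Bernoulli with n = k m gives (1 + 1/m)^(k m) ≥ 1 + k ≥ k. With m = Q-1 this bounds (1 - 1/Q)^(k
  -- (Q-1)) by 1/k.
  k*m^[k*m]≤[1+m]^[k*m] : ∀ m k .{{_ : NonZero m}} → k * m ^ (k * m) ≤ suc m ^ (k * m)
  k*m^[k*m]≤[1+m]^[k*m] m k = *-cancelˡ-≤ m (begin
    m * (k * m ^ (k * m))    ≡⟨ *-assoc m k (m ^ (k * m)) ⟨
    m * k * m ^ (k * m)      ≡⟨ cong (_* m ^ (k * m)) (*-comm m k) ⟩
    k * m * m ^ (k * m)      ≤⟨ *-monoˡ-≤ (m ^ (k * m)) (m≤n+m (k * m) m) ⟩
    (m + k * m) * m ^ (k * m) ≤⟨ bernoulli m (k * m) ⟩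
    m * suc m ^ (k * m)      ∎)
    where open ≤-Reasoning

  k<m^k : ∀ {m} → 1 < m → ∀ k → k < m ^ k
  k<m^k 1<m zero    = ≤-refl
  k<m^k {m} 1<m (suc k) = begin-strict
    suc k        ≤⟨ k<m^k 1<m k ⟩
    m ^ k        <⟨ ^-monoʳ-< m 1<m (n<1+n k) ⟩
    m ^ suc k    ∎
    where open ≤-Reasoning

  -- Levels, hits and their periodicity on cell indices.

  module Cells (P Q N : ℕ) {{P≢0 : NonZero P}} {{Q≢0 : NonZero Q}} where

    -- For j ≤ N this is D / (Q^(N+1-j) P^j), the number of consecutive cells on which the level-j
    -- floor is constant.
    period : ℕ → ℕ
    period j = Q ^ j * P ^ (N ∸ j)

    period≢0 : ∀ j → NonZero (period j)
    period≢0 j = m*n≢0 (Q ^ j) (P ^ (N ∸ j)) {{m^n≢0 Q j}} {{m^n≢0 P (N ∸ j)}}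

    infixl 7 _÷_

    -- For x in the cell [r/D, (r+1)/D), r ÷ j is ⌊Q^(N+1-j) P^j x⌋.
    _÷_ : ℕ → ℕ → ℕ
    r ÷ j = (r / period j) {{period≢0 j}}

    D : ℕ
    D = Q ^ suc N * P ^ N

    hit : ℕ → ℕ → Bool
    hit j r = does (Q ∣? r ÷ j)

    misses : ℕ → ℕ → Bool
    misses zero    r = true
    misses (suc k) r = misses k r ∧ not (hit k r)

    bad : ℕ → Bool
    bad r = hit 0 r ∨ misses (suc N) r

    misses-false : ∀ k r → misses k r ≡ false → ∃ λ j → j < k × hit j r ≡ true
    misses-false (suc k) r eq with misses k r in e | hit k r in e'
    ... | true  | true  = k , ≤-refl , e'
    ... | false | _     with j , j<k , h ← misses-false k r e = j , m<n⇒m<1+n j<k , h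

    good⇒hit : ∀ r → bad r ≡ false → hit 0 r ≡ false × ∃ λ j → j ≤ N × hit j r ≡ true
    good⇒hit r eq with hit 0 r | misses (suc N) r in e
    ... | false | false with j , s≤s j≤N , h ← misses-false (suc N) r e = refl , j , j≤N , h

    Q^k*P^N≡P^k*period : ∀ k → k ≤ N → Q ^ k * P ^ N ≡ P ^ k * period k
    Q^k*P^N≡P^k*period k k≤N = begin
      Q ^ k * P ^ N                    ≡⟨ cong (λ n → Q ^ k * P ^ n) (m+[n∸m]≡n k≤N) ⟨
      Q ^ k * P ^ (k + (N ∸ k))        ≡⟨ cong (Q ^ k *_) (^-distribˡ-+-* P k (N ∸ k)) ⟩
      Q ^ k * (P ^ k * P ^ (N ∸ k))    ≡⟨ solve 3 (λ a b c → a :* (b :* c) := b :* (a :* c)) refl (Q ^ k) (P ^ k) _ ⟩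
      P ^ k * period k                 ∎
      where open ≡-Reasoning
            open +-*-Solver

    -- Moving by `Q * period j` cells adds Q to the level-j quotient, so this is a period of
    -- `hit j`. It divides the shift because Q^(j+1) divides Q^k and P^(N-j) divides P^N.
    Q*period∣ : ∀ {j k} → j < k → k ≤ suc N → Q * period j ∣ Q ^ k * P ^ N
    Q*period∣ {j} {k} j<k k≤1+N = subst (_∣ Q ^ k * P ^ N) (*-assoc Q (Q ^ j) (P ^ (N ∸ j)))
      (*-pres-∣ (a≤b⇒m^a∣m^b {Q} j<k) (a≤b⇒m^a∣m^b {P} (m∸n≤m N j)))
      where
      a≤b⇒m^a∣m^b : ∀ {m a b} → a ≤ b → m ^ a ∣ m ^ b
      a≤b⇒m^a∣m^b {m} {a} {b} a≤b = divides (m ^ (b ∸ a))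
        (trans (cong (m ^_) (sym (m∸n+n≡m a≤b))) (^-distribˡ-+-* m (b ∸ a) a))

    ÷-shift : ∀ j c r → (c * period j + r) ÷ j ≡ c + r ÷ j
    ÷-shift j c r = trans (+-distrib-/-∣ˡ r {{period≢0 j}} (n∣m*n c)) (cong (_+ r ÷ j) (m*n/n≡m c (period j) {{period≢0 j}}))

    -- The shift adds a multiple of Q to the level-j quotient. For k = N+1 it is a shift by whole
    -- multiples of `D`, so hits depend only on the fractional part; smaller k gives the
    -- independence of the levels.
    hit-periodic : ∀ {j k} → j < k → k ≤ suc N → ∀ d r → hit j (d * (Q ^ k * P ^ N) + r) ≡ hit j r
    hit-periodic {j} {k} j<k k≤1+N d r = does-⇔
        (mk⇔ (λ h → ∣m+n∣m⇒∣n (subst (Q ∣_) quotient-eq h) (n∣m*n (d * c)))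
             (λ h → subst (Q ∣_) (sym quotient-eq) (∣m∣n⇒∣m+n (n∣m*n (d * c)) h)))
        (Q ∣? (d * (Q ^ k * P ^ N) + r) ÷ j) (Q ∣? r ÷ j)
      where
      open +-*-Solver
      c : ℕ
      c = _∣_.quotient (Q*period∣ j<k k≤1+N)
      quotient-eq : (d * (Q ^ k * P ^ N) + r) ÷ j ≡ d * c * Q + r ÷ j
      quotient-eq = trans
        (cong (λ t → (t + r) ÷ j) (trans (cong (d *_) (_∣_.equality (Q*period∣ j<k k≤1+N)))
          (solve 4 (λ d c q w → d :* (c :* (q :* w)) := d :* c :* q :* w) refl d c Q (period j))))
        (÷-shift j (d * c * Q) r)

    misses-periodic : ∀ {k l} → k ≤ l → l ≤ suc N → ∀ d r → misses k (d * (Q ^ l * P ^ N) + r) ≡ misses k r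
    misses-periodic {zero}  _   _     d r = refl
    misses-periodic {suc k} k<l l≤1+N d r =
      cong₂ (λ a b → a ∧ not b) (misses-periodic (<⇒≤ k<l) l≤1+N d r) (hit-periodic k<l l≤1+N d r)

    -- Counting the bad cells.

    module _ (P⊥Q : Coprime P Q) where

      -- Shifting by d Q^k P^N adds d P^k to the level-k quotient. Since P^k is invertible modulo Q,
      -- some digit d makes the sum divisible by Q.
      some-hit : ∀ {k} → k ≤ N → ∀ r → ∃ λ d → d < Q × hit k (d * (Q ^ k * P ^ N) + r) ≡ true
      some-hit {k} k≤N r =
        let d , d<Q , Q∣ = coprime⇒linear P^k⊥Q (r ÷ k)
        in d , d<Q , dec-true (Q ∣? (d * (Q ^ k * P ^ N) + r) ÷ k) (subst (Q ∣_) (sym (quotient-eq d)) Q∣)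
        where
        P^k⊥Q : Coprime (P ^ k) Q
        P^k⊥Q = Coprimality.sym (coprime-^ʳ k (Coprimality.sym P⊥Q))
        quotient-eq : ∀ d → (d * (Q ^ k * P ^ N) + r) ÷ k ≡ d * P ^ k + r ÷ k
        quotient-eq d = trans
          (cong (λ t → (t + r) ÷ k)
            (trans (cong (d *_) (Q^k*P^N≡P^k*period k k≤N)) (sym (*-assoc d (P ^ k) (period k)))))
          (÷-shift k (d * P ^ k) r)

      -- Each level contributes a factor Q-1 instead of Q: among the Q translates of a cell by
      -- multiples of `L`, the earlier levels agree by periodicity, while level k is hit by at least
      -- one.
      count-misses : ∀ k → k ≤ suc N → ∑ (Q ^ k * P ^ N) (λ r → 𝟙 (misses k r)) ≤ pred Q ^ k * P ^ N
      count-misses zero    _     = ≤-reflexive (trans (∑-const (1 * P ^ N) 1) (*-identityʳ _))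
      count-misses (suc k) (s≤s k≤N) = begin
        ∑ (Q ^ suc k * P ^ N) (λ r → 𝟙 (misses (suc k) r))
          ≡⟨ cong (λ n → ∑ n (λ r → 𝟙 (misses (suc k) r))) (*-assoc Q (Q ^ k) (P ^ N)) ⟩
        ∑ (Q * L) (λ r → 𝟙 (misses (suc k) r))
          ≡⟨ ∑-blocks Q L (λ r → 𝟙 (misses (suc k) r)) ⟩
        ∑ Q (λ d → ∑ L (λ r → 𝟙 (misses (suc k) (d * L + r))))
          -- From here on `r` is fixed in the inner sum and only the digit `d` varies, so the factor
          -- for the earlier levels can be pulled out.
          ≡⟨ ∑-swap Q L (λ d r → 𝟙 (misses (suc k) (d * L + r))) ⟩
        ∑ L (λ r → ∑ Q (λ d → 𝟙 (misses (suc k) (d * L + r))))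
          ≡⟨ ∑-cong L (λ r _ → ∑-cong Q (λ d _ → factor r d)) ⟩
        ∑ L (λ r → ∑ Q (λ d → 𝟙 (misses k r) * 𝟙 (not (hit k (d * L + r)))))
          ≡⟨ ∑-cong L (λ r _ → ∑-*ˡ Q (𝟙 (misses k r)) (λ d → 𝟙 (not (hit k (d * L + r))))) ⟩
        ∑ L (λ r → 𝟙 (misses k r) * ∑ Q (λ d → 𝟙 (not (hit k (d * L + r)))))
          ≤⟨ ∑-mono L (λ r _ → *-monoʳ-≤ (𝟙 (misses k r)) (few r)) ⟩
        ∑ L (λ r → 𝟙 (misses k r) * pred Q)
          ≡⟨ ∑-*ʳ L (pred Q) (λ r → 𝟙 (misses k r)) ⟩
        ∑ L (λ r → 𝟙 (misses k r)) * pred Q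
          ≤⟨ *-monoˡ-≤ (pred Q) (count-misses k (m≤n⇒m≤1+n k≤N)) ⟩
        pred Q ^ k * P ^ N * pred Q
          ≡⟨ solve 3 (λ a b c → a :* b :* c := c :* a :* b) refl (pred Q ^ k) (P ^ N) (pred Q) ⟩
        pred Q ^ suc k * P ^ N ∎
        where
        open ≤-Reasoning
        open +-*-Solver
        L : ℕ
        L = Q ^ k * P ^ N
        factor : ∀ r d → 𝟙 (misses (suc k) (d * L + r)) ≡ 𝟙 (misses k r) * 𝟙 (not (hit k (d * L + r)))
        factor r d = trans (𝟙-∧ (misses k (d * L + r)) (not (hit k (d * L + r))))
          (cong (λ b → 𝟙 b * 𝟙 (not (hit k (d * L + r)))) (misses-periodic ≤-refl (m≤n⇒m≤1+n k≤N) d r))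
        few : ∀ r → ∑ Q (λ d → 𝟙 (not (hit k (d * L + r)))) ≤ pred Q
        few r = let d , d<Q , h = some-hit k≤N r in count-not< (λ d → hit k (d * L + r)) d<Q h

    -- Within the first Q P^N cells the level-0 quotient is below Q, so it is divisible by Q only
    -- when it vanishes, that is on the first P^N cells.
    hit-first : ∀ r → r < Q * P ^ N → 𝟙 (hit 0 r) ≤ 𝟙 (r <ᵇ P ^ N)
    hit-first r r<QP with r <ᵇ P ^ N in e
    ... | true  = 𝟙≤1 (hit 0 r)
    ... | false = ≤-reflexive (cong 𝟙 (dec-false (Q ∣? r ÷ 0) (>⇒∤ {{>-nonZero r÷0>0}} r÷0<Q)))
      where
      period₀ : period 0 ≡ P ^ N
      period₀ = *-identityˡ (P ^ N)
      P≤r : P ^ N ≤ r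
      P≤r = ≮⇒≥ (λ r<P → subst T e (<⇒<ᵇ r<P))
      r÷0>0 : 0 < r ÷ 0
      r÷0>0 = m≥n⇒m/n>0 {{period≢0 0}} (subst (_≤ r) (sym period₀) P≤r)
      r÷0<Q : r ÷ 0 < Q
      r÷0<Q = m<n*o⇒m/o<n {{period≢0 0}} (subst (λ t → r < Q * t) (sym period₀) r<QP)

    count-hit0 : ∑ D (λ r → 𝟙 (hit 0 r)) ≤ Q ^ N * P ^ N
    count-hit0 = begin
      ∑ D (λ r → 𝟙 (hit 0 r))
        -- The cells are split into Q^N full periods of level 0; the length is written with `Q ^ 1`
        -- to match `hit-periodic` at k = 1.
        ≡⟨ cong (λ n → ∑ n (λ r → 𝟙 (hit 0 r)))
             (solve 3 (λ q a b → q :* a :* b := a :* (q :* con 1 :* b)) refl Q (Q ^ N) (P ^ N)) ⟩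
      ∑ (Q ^ N * (Q ^ 1 * P ^ N)) (λ r → 𝟙 (hit 0 r))
        ≡⟨ ∑-blocks (Q ^ N) (Q ^ 1 * P ^ N) (λ r → 𝟙 (hit 0 r)) ⟩
      ∑ (Q ^ N) (λ d → ∑ (Q ^ 1 * P ^ N) (λ r → 𝟙 (hit 0 (d * (Q ^ 1 * P ^ N) + r))))
        ≡⟨ ∑-cong (Q ^ N) (λ d _ → ∑-cong (Q ^ 1 * P ^ N) (λ r _ → cong 𝟙 (hit-periodic {0} {1} ≤-refl (s≤s z≤n) d r))) ⟩
      ∑ (Q ^ N) (λ d → ∑ (Q ^ 1 * P ^ N) (λ r → 𝟙 (hit 0 r)))
        ≡⟨ ∑-const (Q ^ N) (∑ (Q ^ 1 * P ^ N) (λ r → 𝟙 (hit 0 r))) ⟩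
      Q ^ N * ∑ (Q ^ 1 * P ^ N) (λ r → 𝟙 (hit 0 r))
        ≤⟨ *-monoʳ-≤ (Q ^ N) (≤-trans
             (∑-mono (Q ^ 1 * P ^ N) (λ r r< → hit-first r (subst (λ q → r < q * P ^ N) (*-identityʳ Q) r<)))
             (count-< (P ^ N) (Q ^ 1 * P ^ N))) ⟩
      Q ^ N * P ^ N ∎
      where open ≤-Reasoning
            open +-*-Solver

    count-bad : Coprime P Q → ∑ D (λ r → 𝟙 (bad r)) ≤ Q ^ N * P ^ N + pred Q ^ suc N * P ^ N
    count-bad P⊥Q = begin
      ∑ D (λ r → 𝟙 (bad r))                                       ≤⟨ ∑-mono D (λ r _ → 𝟙-∨ (hit 0 r) _) ⟩
      ∑ D (λ r → 𝟙 (hit 0 r) + 𝟙 (misses (suc N) r))              ≡⟨ ∑-distrib-+ D _ _ ⟩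
      ∑ D (λ r → 𝟙 (hit 0 r)) + ∑ D (λ r → 𝟙 (misses (suc N) r))  ≤⟨ +-mono-≤ count-hit0 (count-misses P⊥Q (suc N) ≤-refl) ⟩
      Q ^ N * P ^ N + pred Q ^ suc N * P ^ N                      ∎
      where open ≤-Reasoning

    -- The bad share is at most 1/Q + (1 - 1/Q)^(N+1). The first term is at most 1/M as M ≤ Q, the
    -- second by Bernoulli as N+1 = M (Q-1).
    few-bad : ∀ M .{{_ : NonZero (pred Q)}} → Coprime P Q → M ≤ Q → suc N ≡ M * pred Q →
      M * ∑ D (λ r → 𝟙 (bad r)) ≤ 2 * D
    few-bad M P⊥Q M≤Q eq = begin
      M * ∑ D (λ r → 𝟙 (bad r))
        ≤⟨ *-monoʳ-≤ M (count-bad P⊥Q) ⟩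
      M * (Q ^ N * P ^ N + pred Q ^ suc N * P ^ N)
        ≡⟨ solve 4 (λ m a b c → m :* (a :* b :+ c :* b) := m :* a :* b :+ m :* c :* b) refl M (Q ^ N) (P ^ N) (pred Q ^ suc N) ⟩
      M * Q ^ N * P ^ N + M * pred Q ^ suc N * P ^ N
        ≤⟨ +-mono-≤ (*-monoˡ-≤ (P ^ N) (*-monoˡ-≤ (Q ^ N) M≤Q)) (*-monoˡ-≤ (P ^ N) power) ⟩
      D + D
        ≡⟨ cong (D +_) (+-identityʳ D) ⟨
      2 * D ∎
      where
      open ≤-Reasoning
      open +-*-Solver
      power : M * pred Q ^ suc N ≤ Q ^ suc N
      power = subst₂ (λ e b → M * pred Q ^ e ≤ b ^ e) (sym eq) (suc-pred Q) (k*m^[k*m]≤[1+m]^[k*m] (pred Q) M)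

    -- Comparing levels along the orbit.

    ÷-lower : ∀ r j → r ÷ j * period j ≤ r
    ÷-lower r j = m/n*n≤m r (period j) {{period≢0 j}}

    ÷-upper : ∀ r j → r < suc (r ÷ j) * period j
    ÷-upper r j = begin-strict
      r                                          ≡⟨ m≡m%n+[m/n]*n r (period j) {{period≢0 j}} ⟩
      (r % period j) {{period≢0 j}} + r ÷ j * period j  <⟨ +-monoˡ-< (r ÷ j * period j) (m%n<n r (period j) {{period≢0 j}}) ⟩
      suc (r ÷ j) * period j                     ∎
      where open ≤-Reasoning

    -- Multiplication by (P/Q)^j carries the breakpoints of the level-j floor to those of the
    -- level-0 floor.
    exchange : ∀ {j} → j ≤ N → ∀ a → P ^ j * (a * period j) ≡ Q ^ j * (a * period 0)
    exchange {j} j≤N a = begin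
      P ^ j * (a * period j)    ≡⟨ solve 3 (λ x a w → x :* (a :* w) := a :* (x :* w)) refl (P ^ j) a (period j) ⟩
      a * (P ^ j * period j)    ≡⟨ cong (a *_) (Q^k*P^N≡P^k*period j j≤N) ⟨
      a * (Q ^ j * P ^ N)       ≡⟨ solve 3 (λ x a w → a :* (x :* w) := x :* (a :* (con 1 :* w))) refl (Q ^ j) a (P ^ N) ⟩
      Q ^ j * (a * period 0)    ∎
      where open ≡-Reasoning
            open +-*-Solver

    -- The two negations say that (P/Q)^j times cell `r` overlaps cell `r′`. Were the quotients
    -- different, `exchange` would place a level-0 breakpoint between the two cells.
    ÷-orbit : ∀ {j} → j ≤ N → ∀ r r′ →
      ¬ (P ^ j * suc r ≤ Q ^ j * r′) → ¬ (Q ^ j * suc r′ ≤ P ^ j * r) → r ÷ j ≡ r′ ÷ 0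
    ÷-orbit {j} j≤N r r′ ¬below ¬above with <-cmp (r ÷ j) (r′ ÷ 0)
    ... | tri≈ _ eq _ = eq
    ... | tri< lt _ _ = contradiction (begin
      P ^ j * suc r                         ≤⟨ *-monoʳ-≤ (P ^ j) (÷-upper r j) ⟩
      P ^ j * (suc (r ÷ j) * period j)      ≤⟨ *-monoʳ-≤ (P ^ j) (*-monoˡ-≤ (period j) lt) ⟩
      P ^ j * (r′ ÷ 0 * period j)           ≡⟨ exchange j≤N (r′ ÷ 0) ⟩
      Q ^ j * (r′ ÷ 0 * period 0)           ≤⟨ *-monoʳ-≤ (Q ^ j) (÷-lower r′ 0) ⟩
      Q ^ j * r′                            ∎) ¬below
      where
      open ≤-Reasoning
    ... | tri> _ _ gt = contradiction (begin
      Q ^ j * suc r′                        ≤⟨ *-monoʳ-≤ (Q ^ j) (÷-upper r′ 0) ⟩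
      Q ^ j * (suc (r′ ÷ 0) * period 0)     ≤⟨ *-monoʳ-≤ (Q ^ j) (*-monoˡ-≤ (period 0) gt) ⟩
      Q ^ j * (r ÷ j * period 0)            ≡⟨ exchange j≤N (r ÷ j) ⟨
      P ^ j * (r ÷ j * period j)            ≤⟨ *-monoʳ-≤ (P ^ j) (÷-lower r j) ⟩
      P ^ j * r                             ∎) ¬above
      where
      open ≤-Reasoning

    -- Here `n` and `n′` are integer parts. Periodicity modulo `D` discards them once the full
    -- quotients have been identified.
    hit-orbit : ∀ {j} → j ≤ N → ∀ n r n′ r′ →
      ¬ (P ^ j * suc (n * D + r) ≤ Q ^ j * (n′ * D + r′)) →
      ¬ (Q ^ j * suc (n′ * D + r′) ≤ P ^ j * (n * D + r)) →
      hit j r ≡ hit 0 r′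
    hit-orbit {j} j≤N n r n′ r′ ¬below ¬above = begin
      hit j r                ≡⟨ hit-periodic (s≤s j≤N) ≤-refl n r ⟨
      hit j (n * D + r)      ≡⟨ cong (λ a → does (Q ∣? a)) (÷-orbit j≤N (n * D + r) (n′ * D + r′) ¬below ¬above) ⟩
      hit 0 (n′ * D + r′)    ≡⟨ hit-periodic (s≤s z≤n) ≤-refl n′ r′ ⟩
      hit 0 r′               ∎
      where open ≡-Reasoning

open Arithmetic using (∑; 𝟙; count-not; coprime-^; k<m^k; module Cells)

open import Defs
open import Level using (0ℓ)
open import Data.Bool using (Bool; true; false; not; if_then_else_)
open import Data.Empty using (⊥-elim)
open import Data.Integer as ℤ using (+_; -[1+_])
import Data.Integer.Properties as ℤ
open import Data.List using (List; []; _∷_)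
open import Data.List.Relation.Unary.All using (All; []; _∷_)
open import Data.List.Relation.Unary.AllPairs using ([]; _∷_)
open import Data.List.Relation.Unary.Any using (here; there)
open import Data.Nat as ℕ using (ℕ; zero; suc; NonZero)
import Data.Nat.Properties as ℕ
open import Data.Nat.Coprimality using (Coprime)
open import Data.Product using (Σ; ∃; _×_; _,_; proj₁; proj₂)
open import Data.Rational as ℚ using (ℚ; 0ℚ; 1ℚ; mkℚ)
import Data.Rational.Properties as ℚ
open import Data.Rational.Solver using (module +-*-Solver)
open import Data.Rational.Unnormalised as ℚᵘ using (mkℚᵘ; *≡*)
import Data.Rational.Unnormalised.Properties as ℚᵘ
open import Relation.Binary.PropositionalEquality using (_≡_; refl; sym; trans; cong; cong₂; subst; module ≡-Reasoning)
open import Relation.Nullary using (¬_)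
open import Relation.Unary using (Pred; _∈_; _⊆_; Empty)

-- Naturals inside the rationals, and the Archimedean property.

toℚᵘ-/ : ∀ n d .{{_ : NonZero d}} → ℚ.toℚᵘ (+ n ℚ./ d) ℚᵘ.≃ (+ n ℚᵘ./ d)
toℚᵘ-/ n (suc d) = ℚ.toℚᵘ-fromℚᵘ (mkℚᵘ (+ n) d)

-- Opaque, because unfolding normalised fractions makes conversion checking blow up.
opaque
  ι : ℕ → ℚ
  ι n = + n ℚ./ 1

  ι-def : ∀ n → + n ℚ./ 1 ≡ ι n
  ι-def n = refl

  ι-homo-+ : ∀ m n → ι (m ℕ.+ n) ≡ ι m ℚ.+ ι n
  ι-homo-+ m n = ℚ.toℚᵘ-injective (begin
    ℚ.toℚᵘ (ι (m ℕ.+ n))               ≈⟨ toℚᵘ-/ (m ℕ.+ n) 1 ⟩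
    + (m ℕ.+ n) ℚᵘ./ 1                 ≈⟨ *≡* (cong (ℤ._* + 1)
      (sym (cong₂ ℤ._+_ (ℤ.*-identityʳ (+ m)) (ℤ.*-identityʳ (+ n))))) ⟩
    (+ m ℚᵘ./ 1) ℚᵘ.+ (+ n ℚᵘ./ 1)     ≈⟨ ℚᵘ.+-cong (toℚᵘ-/ m 1) (toℚᵘ-/ n 1) ⟨
    ℚ.toℚᵘ (ι m) ℚᵘ.+ ℚ.toℚᵘ (ι n)     ≈⟨ ℚ.toℚᵘ-homo-+ (ι m) (ι n) ⟨
    ℚ.toℚᵘ (ι m ℚ.+ ι n)               ∎)
    where open import Relation.Binary.Reasoning.Setoid ℚᵘ.≃-setoid

  ι-homo-* : ∀ m n → ι (m ℕ.* n) ≡ ι m ℚ.* ι n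
  ι-homo-* m n = ℚ.toℚᵘ-injective (begin
    ℚ.toℚᵘ (ι (m ℕ.* n))               ≈⟨ toℚᵘ-/ (m ℕ.* n) 1 ⟩
    + (m ℕ.* n) ℚᵘ./ 1                 ≈⟨ *≡* (cong (ℤ._* + 1) (ℤ.pos-* m n)) ⟩
    (+ m ℚᵘ./ 1) ℚᵘ.* (+ n ℚᵘ./ 1)     ≈⟨ ℚᵘ.*-cong (toℚᵘ-/ m 1) (toℚᵘ-/ n 1) ⟨
    ℚ.toℚᵘ (ι m) ℚᵘ.* ℚ.toℚᵘ (ι n)     ≈⟨ ℚ.toℚᵘ-homo-* (ι m) (ι n) ⟨
    ℚ.toℚᵘ (ι m ℚ.* ι n)               ∎)
    where open import Relation.Binary.Reasoning.Setoid ℚᵘ.≃-setoid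

  ι-nonNeg : ∀ n → ℚ.NonNegative (ι n)
  ι-nonNeg n = ℚ.normalize-nonNeg n 1

  ι-pos : ∀ n .{{_ : NonZero n}} → ℚ.Positive (ι n)
  ι-pos n = ℚ.normalize-pos n 1

  ι[d]*n/d : ∀ n d .{{_ : NonZero d}} → ι d ℚ.* (+ n ℚ./ d) ≡ ι n
  ι[d]*n/d n d@(suc d-1) = ℚ.toℚᵘ-injective (begin
    ℚ.toℚᵘ (ι d ℚ.* (+ n ℚ./ d))            ≈⟨ ℚ.toℚᵘ-homo-* (ι d) (+ n ℚ./ d) ⟩
    ℚ.toℚᵘ (ι d) ℚᵘ.* ℚ.toℚᵘ (+ n ℚ./ d)    ≈⟨ ℚᵘ.*-cong (toℚᵘ-/ d 1) (toℚᵘ-/ n d) ⟩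
    (+ d ℚᵘ./ 1) ℚᵘ.* (+ n ℚᵘ./ d)          ≈⟨ *≡* cross ⟩
    + n ℚᵘ./ 1                              ≈⟨ toℚᵘ-/ n 1 ⟨
    ℚ.toℚᵘ (ι n)                            ∎)
    where
    open import Relation.Binary.Reasoning.Setoid ℚᵘ.≃-setoid
    cross : + d ℤ.* + n ℤ.* + 1 ≡ + n ℤ.* + (1 ℕ.* d)
    cross = trans (ℤ.*-identityʳ (+ d ℤ.* + n))
      (trans (ℤ.*-comm (+ d) (+ n)) (cong (λ k → + n ℤ.* + k) (sym (ℕ.*-identityˡ d))))

ι-mono-≤ : ∀ {m n} → m ℕ.≤ n → ι m ℚ.≤ ι n
ι-mono-≤ {m} {n} m≤n = begin
  ι m                    ≡⟨ ℚ.+-identityʳ (ι m) ⟨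
  ι m ℚ.+ 0ℚ             ≤⟨ ℚ.+-monoʳ-≤ (ι m) (ℚ.nonNegative⁻¹ (ι (n ℕ.∸ m)) {{ι-nonNeg (n ℕ.∸ m)}}) ⟩
  ι m ℚ.+ ι (n ℕ.∸ m)    ≡⟨ ι-homo-+ m (n ℕ.∸ m) ⟨
  ι (m ℕ.+ (n ℕ.∸ m))    ≡⟨ cong ι (ℕ.m+[n∸m]≡n m≤n) ⟩
  ι n                    ∎
  where open ℚ.≤-Reasoning

archimedean : ∀ k δ → 0ℚ ℚ.< δ → ∃ λ n → NonZero n × ι k ℚ.≤ ι n ℚ.* δ
-- Multiplying δ by its denominator leaves the numerator `suc a`, at least 1. The factor `suc k`
-- keeps the witness nonzero even for k = 0.
archimedean k δ@(mkℚ (+ suc a) d-1 _) _ = suc k ℕ.* suc d-1 , _ , (begin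
  ι k                                   ≤⟨ ι-mono-≤ (ℕ.≤-trans (ℕ.n≤1+n k) (ℕ.m≤m*n (suc k) (suc a))) ⟩
  ι (suc k ℕ.* suc a)                   ≡⟨ ι-homo-* (suc k) (suc a) ⟩
  ι (suc k) ℚ.* ι (suc a)               ≡⟨ cong (ι (suc k) ℚ.*_) (ι[d]*n/d (suc a) (suc d-1)) ⟨
  ι (suc k) ℚ.* (ι (suc d-1) ℚ.* (+ suc a ℚ./ suc d-1))
    ≡⟨ cong (λ r → ι (suc k) ℚ.* (ι (suc d-1) ℚ.* r)) (ℚ.↥p/↧p≡p δ) ⟩
  ι (suc k) ℚ.* (ι (suc d-1) ℚ.* δ)     ≡⟨ ℚ.*-assoc (ι (suc k)) (ι (suc d-1)) δ ⟨
  ι (suc k) ℚ.* ι (suc d-1) ℚ.* δ       ≡⟨ cong (ℚ._* δ) (ι-homo-* (suc k) (suc d-1)) ⟨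
  ι (suc k ℕ.* suc d-1) ℚ.* δ           ∎)
  where open ℚ.≤-Reasoning
archimedean k (mkℚ (+ zero) _ _)  (ℚ.*<* (ℤ.+<+ ()))
archimedean k (mkℚ -[1+ _ ] _ _) (ℚ.*<* ())

-- Strict inequalities against rational constants, and rational powers.

p≤q+r⇒p-q≤r : ∀ p q r → p ℚ.≤ q ℚ.+ r → p ℚ.- q ℚ.≤ r
p≤q+r⇒p-q≤r p q r p≤q+r = ℚ.≤-trans (ℚ.+-monoˡ-≤ (ℚ.- q) p≤q+r)
  (ℚ.≤-reflexive (solve 2 (λ q r → (q :+ r) :- q := r) refl q r))
  where open +-*-Solver

p+δ≰q : ∀ {p q δ} → 0ℚ ℚ.< δ → q ℚ.≤ p → ¬ (p ℚ.+ δ ℚ.≤ q)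
p+δ≰q {p} {q} {δ} δ>0 q≤p p+δ≤q = ℚ.<-irrefl refl (begin-strict
  p            ≡⟨ ℚ.+-identityʳ p ⟨
  p ℚ.+ 0ℚ     <⟨ ℚ.+-monoʳ-< p δ>0 ⟩
  p ℚ.+ δ      ≤⟨ p+δ≤q ⟩
  q            ≤⟨ q≤p ⟩
  p            ∎)
  where open ℚ.≤-Reasoning

<-weaken : ∀ {x a b} → a ℚ.≤ b → x < fromℚ a → x < fromℚ b
<-weaken a≤b (δ , δ>0 , K , h) = δ , δ>0 , K , λ m m≥ → ℚ.≤-trans (h m m≥) a≤b

sub-< : ∀ {x n c} → x < fromℚ ((n ℚ./ 1) ℚ.+ c) → x - fromℤ n < fromℚ c
sub-< {x} {n} {c} (δ , δ>0 , K , h) = δ , δ>0 , K , λ m m≥ → ℚ.≤-trans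
  (ℚ.≤-reflexive (solve 3 (λ x n δ → (x :- n) :+ δ := (x :+ δ) :- n) refl (seq x m) (n ℚ./ 1) δ))
  (p≤q+r⇒p-q≤r _ (n ℚ./ 1) c (h m m≥))
  where open +-*-Solver

add-< : ∀ {x n c} → x - fromℤ n < fromℚ c → x < fromℚ ((n ℚ./ 1) ℚ.+ c)
add-< {x} {n} {c} (δ , δ>0 , K , h) = δ , δ>0 , K , λ m m≥ → ℚ.≤-trans
  (ℚ.≤-reflexive (solve 3 (λ x n δ → x :+ δ := n :+ ((x :- n) :+ δ)) refl (seq x m) (n ℚ./ 1) δ))
  (ℚ.+-monoʳ-≤ (n ℚ./ 1) (h m m≥))
  where open +-*-Solver

<-scale : ∀ α .{{_ : ℚ.Positive α}} {x a} → x < fromℚ a → x * fromℚ α < fromℚ (a ℚ.* α)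
<-scale α {x} {a} (δ , δ>0 , K , h) =
  δ ℚ.* α , ℚ.positive⁻¹ (δ ℚ.* α) {{ℚ.pos*pos⇒pos δ {{ℚ.positive δ>0}} α}} , K , λ m m≥ →
    ℚ.≤-trans (ℚ.≤-reflexive (sym (ℚ.*-distribʳ-+ α (seq x m) δ)))
      (ℚ.*-monoʳ-≤-nonNeg α {{ℚ.pos⇒nonNeg α}} (h m m≥))

pow : ℚ → ℕ → ℚ
pow t zero    = 1ℚ
pow t (suc i) = t ℚ.* pow t i

seq-^ : ∀ t i n → seq (fromℚ t ^ i) n ≡ pow t i
seq-^ t zero    n = refl
seq-^ t (suc i) n = cong (t ℚ.*_) (seq-^ t i n)

ι-pow : ∀ p q .{{_ : NonZero q}} i → ι (q ℕ.^ i) ℚ.* pow (+ p ℚ./ q) i ≡ ι (p ℕ.^ i)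
ι-pow p q zero    = ℚ.*-identityʳ (ι 1)
ι-pow p q (suc i) = begin
  ι (q ℕ.* q ℕ.^ i) ℚ.* (t ℚ.* pow t i)             ≡⟨ cong (ℚ._* (t ℚ.* pow t i)) (ι-homo-* q (q ℕ.^ i)) ⟩
  ι q ℚ.* ι (q ℕ.^ i) ℚ.* (t ℚ.* pow t i)
    ≡⟨ solve 4 (λ a b c d → a :* b :* (c :* d) := (a :* c) :* (b :* d)) refl (ι q) (ι (q ℕ.^ i)) t (pow t i) ⟩
  ι q ℚ.* t ℚ.* (ι (q ℕ.^ i) ℚ.* pow t i)           ≡⟨ cong₂ ℚ._*_ (ι[d]*n/d p q) (ι-pow p q i) ⟩
  ι p ℚ.* ι (p ℕ.^ i)                               ≡⟨ ι-homo-* p (p ℕ.^ i) ⟨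
  ι (p ℕ.* p ℕ.^ i)                                 ∎
  where
  open ≡-Reasoning
  open +-*-Solver
  t : ℚ
  t = + p ℚ./ q

-- The grid of mesh 1/D and unions of its cells.

module Grid (D : ℕ) {{D≢0 : NonZero D}} where

  opaque
    u : ℚ
    u = + 1 ℚ./ D

    u>0 : ℚ.Positive u
    u>0 = ℚ.normalize-pos 1 D

    grid : ℕ → ℚ
    grid r = ι r ℚ.* u

    grid-mono-≤ : ∀ {r s} → r ℕ.≤ s → grid r ℚ.≤ grid s
    grid-mono-≤ r≤s = ℚ.*-monoʳ-≤-nonNeg u {{ℚ.pos⇒nonNeg u {{u>0}}}} (ι-mono-≤ r≤s)

    grid-+ : ∀ r s → grid (r ℕ.+ s) ≡ grid r ℚ.+ grid s
    grid-+ r s = trans (cong (ℚ._* u) (ι-homo-+ r s)) (ℚ.*-distribʳ-+ u (ι r) (ι s))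

    grid-* : ∀ r s → grid (r ℕ.* s) ≡ ι r ℚ.* grid s
    grid-* r s = trans (cong (ℚ._* u) (ι-homo-* r s)) (ℚ.*-assoc (ι r) (ι s) u)

    grid-D : grid D ≡ 1ℚ
    grid-D = trans (ι[d]*n/d 1 D) (sym (ι-def 1))

    grid-0 : grid 0 ≡ 0ℚ
    grid-0 = trans (cong (ℚ._* u) (sym (ι-def 0))) (ℚ.*-zeroˡ u)

  grid-int : ∀ n r → grid (n ℕ.* D ℕ.+ r) ≡ ι n ℚ.+ grid r
  grid-int n r = trans (grid-+ (n ℕ.* D) r)
    (cong (ℚ._+ grid r) (trans (grid-* n D) (trans (cong (ι n ℚ.*_) grid-D) (ℚ.*-identityʳ (ι n)))))

  -- Half-open, so that neighbouring cells are disjoint.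
  cell : ℕ → Interval
  cell r = record
    { lo        = fromℚ (grid r)
    ; hi        = fromℚ (grid (suc r))
    ; lo≤hi     = λ (δ , δ>0 , K , h) → p+δ≰q δ>0 (grid-mono-≤ (ℕ.n≤1+n r)) (h K ℕ.≤-refl)
    ; lo-closed = true
    ; hi-closed = false
    }

  cells : (ℕ → Bool) → ℕ → List Interval
  cells b zero    = []
  cells b (suc n) = if b n then cell n ∷ cells b n else cells b n

  ∈-cells : ∀ b n {x} → x ∈ ⋃ (cells b n) → ∃ λ r → r ℕ.< n × b r ≡ true × x ∈ ⟦ cell r ⟧
  ∈-cells b (suc n) x∈ with b n in e
  ∈-cells b (suc n) (here x∈)  | true = n , ℕ.≤-refl , e , x∈
  ∈-cells b (suc n) (there x∈) | true with r , r<n , br , h ← ∈-cells b n x∈ = r , ℕ.m<n⇒m<1+n r<n , br , h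
  ∈-cells b (suc n) x∈         | false with r , r<n , br , h ← ∈-cells b n x∈ = r , ℕ.m<n⇒m<1+n r<n , br , h

  cells-disjoint : ∀ b n → PairwiseDisjoint (cells b n)
  cells-disjoint b zero    = []
  cells-disjoint b (suc n) with b n
  ... | true  = later n ℕ.≤-refl ∷ cells-disjoint b n
    where
    -- The list runs downwards, so the head meets only cells with k < n. A common point would be
    -- below (k+1)/D ≤ n/D, yet not below n/D.
    later : ∀ k → k ℕ.≤ n → All (λ J → ∀ x → ¬ (x ∈ ⟦ cell n ⟧ × x ∈ ⟦ J ⟧)) (cells b k)
    later zero    _   = []
    later (suc k) k<n with b k
    ... | true  = (λ x ((n≤x , _) , (_ , x<1+k)) → n≤x (<-weaken {x} (grid-mono-≤ k<n) x<1+k)) ∷ later k (ℕ.<⇒≤ k<n)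
    ... | false = later k (ℕ.<⇒≤ k<n)
  ... | false = cells-disjoint b n

  cells⊆[0,1⟩ : ∀ b → ⋃ (cells b D) ⊆ [0,1⟩
  cells⊆[0,1⟩ b {x} x∈ with r , r<D , _ , r≤x , x<1+r ← ∈-cells b D x∈ =
    (λ x<0 → r≤x (<-weaken {x} (subst (ℚ._≤ grid r) grid-0 (grid-mono-≤ {0} {r} ℕ.z≤n)) x<0)) ,
    <-weaken {x} (subst (grid (suc r) ℚ.≤_) grid-D (grid-mono-≤ r<D)) x<1+r

  -- All ends are constant sequences, so every term of the total length is the same rational and
  -- lengths can be compared term by term.
  cells-length : ∀ b n m → seq (totalLength (cells b n)) m ≡ grid (∑ n (λ r → 𝟙 (b r)))
  cells-length b zero    m = sym grid-0
  cells-length b (suc n) m with b n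
  ... | false = trans (cells-length b n m) (cong grid (sym (ℕ.+-identityʳ (∑ n (λ r → 𝟙 (b r))))))
  ... | true  = begin
    (grid (suc n) ℚ.- grid n) ℚ.+ seq (totalLength (cells b n)) m
      ≡⟨ cong₂ (λ g l → (g ℚ.- grid n) ℚ.+ l) (grid-+ 1 n) (cells-length b n m) ⟩
    ((grid 1 ℚ.+ grid n) ℚ.- grid n) ℚ.+ grid k
      ≡⟨ solve 3 (λ a b c → ((a :+ b) :- b) :+ c := c :+ a) refl (grid 1) (grid n) (grid k) ⟩
    grid k ℚ.+ grid 1
      ≡⟨ grid-+ k 1 ⟨
    grid (k ℕ.+ 1) ∎
    where
    open ≡-Reasoning
    open +-*-Solver
    k : ℕ
    k = ∑ n (λ r → 𝟙 (b r))

-- Orbit points and their positions on the grid.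

<-resp-seq : ∀ {x y a} → (∀ m → seq x m ≡ seq y m) → x < fromℚ a → y < fromℚ a
<-resp-seq {a = a} x≗y (δ , δ>0 , K , h) = δ , δ>0 , K , λ m m≥ →
  subst (λ s → s ℚ.+ δ ℚ.≤ a) (x≗y m) (h m m≥)

pow-pos : ∀ t .{{_ : ℚ.Positive t}} i → ℚ.Positive (pow t i)
pow-pos t zero    = _
pow-pos t (suc i) = ℚ.pos*pos⇒pos t (pow t i) {{pow-pos t i}}

module Orbit (t : ℚ) {{t>0 : ℚ.Positive t}} (D : ℕ) {{D≢0 : NonZero D}} (ξ : ℝ) where

  open Grid D

  seq-orbit : ∀ i m → seq (ξ * fromℚ t ^ i) m ≡ seq ξ m ℚ.* pow t i
  seq-orbit i m = cong (seq ξ m ℚ.*_) (seq-^ t i m)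

  -- The equation says that the orbit point at time `i′` is α/β times the one at time `i`, so the
  -- bound is scaled by α/β. The cross-multiplied form serves both directions of time.
  orbit-transfer : ∀ α β .{{_ : NonZero α}} .{{_ : NonZero β}} {i i′} → ι β ℚ.* pow t i′ ≡ ι α ℚ.* pow t i →
    ∀ {a a′} → α ℕ.* a ℕ.≤ β ℕ.* a′ → ξ * fromℚ t ^ i < fromℚ (grid a) → ξ * fromℚ t ^ i′ < fromℚ (grid a′)
  orbit-transfer α β {i} {i′} eq {a} {a′} αa≤βa′ x<a =
    <-weaken {ξ * fromℚ t ^ i′} γa≤a′
      (<-resp-seq {ξ * fromℚ t ^ i * fromℚ γ} {ξ * fromℚ t ^ i′} seq-eq
        (<-scale γ {{γ>0}} {ξ * fromℚ t ^ i} x<a))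
    where
    γ : ℚ
    γ = + α ℚ./ β
    γ>0 : ℚ.Positive γ
    γ>0 = ℚ.normalize-pos α β
    βpos : ℚ.Positive (ι β)
    βpos = ι-pos β
    scale : ∀ r → ι β ℚ.* (r ℚ.* γ) ≡ ι α ℚ.* r
    scale r = trans (solve 3 (λ b r c → b :* (r :* c) := (b :* c) :* r) refl (ι β) r γ)
      (cong (ℚ._* r) (ι[d]*n/d α β))
      where open +-*-Solver
    γa≤a′ : grid a ℚ.* γ ℚ.≤ grid a′
    γa≤a′ = ℚ.*-cancelˡ-≤-pos (ι β) {{βpos}} (begin
      ι β ℚ.* (grid a ℚ.* γ)   ≡⟨ scale (grid a) ⟩
      ι α ℚ.* grid a           ≡⟨ grid-* α a ⟨
      grid (α ℕ.* a)           ≤⟨ grid-mono-≤ αa≤βa′ ⟩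
      grid (β ℕ.* a′)          ≡⟨ grid-* β a′ ⟩
      ι β ℚ.* grid a′          ∎)
      where open ℚ.≤-Reasoning
    pow-eq : pow t i ℚ.* γ ≡ pow t i′
    -- Cancellation of the positive factor `ι β` is applied to each of the two inequalities.
    pow-eq = ℚ.≤-antisym
      (ℚ.*-cancelˡ-≤-pos (ι β) {{βpos}} (ℚ.≤-reflexive (trans (scale (pow t i)) (sym eq))))
      (ℚ.*-cancelˡ-≤-pos (ι β) {{βpos}} (ℚ.≤-reflexive (trans eq (sym (scale (pow t i))))))
    seq-eq : ∀ m → seq (ξ * fromℚ t ^ i) m ℚ.* γ ≡ seq (ξ * fromℚ t ^ i′) m
    seq-eq m = begin
      seq (ξ * fromℚ t ^ i) m ℚ.* γ  ≡⟨ cong (ℚ._* γ) (seq-orbit i m) ⟩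
      seq ξ m ℚ.* pow t i ℚ.* γ      ≡⟨ ℚ.*-assoc (seq ξ m) (pow t i) γ ⟩
      seq ξ m ℚ.* (pow t i ℚ.* γ)    ≡⟨ cong (seq ξ m ℚ.*_) pow-eq ⟩
      seq ξ m ℚ.* pow t i′           ≡⟨ seq-orbit i′ m ⟨
      seq (ξ * fromℚ t ^ i′) m       ∎
      where open ≡-Reasoning

  -- A negative floor n would give x < n + 1 ≤ 0, although ξ and the powers of t are positive.
  -- Integer parts can thus be naturals.
  floor-nonNeg : 0ℝ < ξ → ∀ i {n} → IsFloor (ξ * fromℚ t ^ i) n → ∃ λ k → n ≡ + k
  floor-nonNeg _ i {+ k} _ = k , refl
  floor-nonNeg (δ₀ , δ₀>0 , K₀ , h₀) i { -[1+ k ]} (_ , δ , δ>0 , K , h) =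
    ⊥-elim (p+δ≰q δ>0 (ℚ.≤-trans floor≤0 0≤x) (h m (ℕ.m≤n⊔m K₀ K)))
    where
    open ℚ.≤-Reasoning
    m : ℕ
    m = K₀ ℕ.⊔ K
    floor≤0 : (-[1+ k ] ℚ./ 1) ℚ.+ 1ℚ ℚ.≤ 0ℚ
    floor≤0 = begin
      ℚ.- (+ suc k ℚ./ 1) ℚ.+ 1ℚ       ≡⟨ cong₂ (λ a b → ℚ.- a ℚ.+ b) (ι-def (suc k)) (ι-def 1) ⟩
      ℚ.- ι (suc k) ℚ.+ ι 1            ≤⟨ ℚ.+-monoʳ-≤ (ℚ.- ι (suc k)) (ι-mono-≤ {1} {suc k} (ℕ.s≤s ℕ.z≤n)) ⟩
      ℚ.- ι (suc k) ℚ.+ ι (suc k)      ≡⟨ ℚ.+-inverseˡ (ι (suc k)) ⟩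
      0ℚ                               ∎
    0≤x : 0ℚ ℚ.≤ seq (ξ * fromℚ t ^ i) m
    0≤x = begin
      0ℚ                               ≡⟨ ℚ.*-zeroˡ (pow t i) ⟨
      0ℚ ℚ.* pow t i                   ≤⟨ ℚ.*-monoʳ-≤-nonNeg (pow t i) {{ℚ.pos⇒nonNeg (pow t i) {{pow-pos t i}}}} 0≤ξ ⟩
      seq ξ m ℚ.* pow t i              ≡⟨ seq-orbit i m ⟨
      seq (ξ * fromℚ t ^ i) m          ∎
      where
      0≤ξ : 0ℚ ℚ.≤ seq ξ m
      0≤ξ = ℚ.≤-trans (ℚ.≤-trans (ℚ.<⇒≤ δ₀>0) (ℚ.≤-reflexive (sym (ℚ.+-identityˡ δ₀)))) (h₀ m (ℕ.m≤m⊔n K₀ K))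

  -- `k` stands for the integer part and `r` for the cell of the fractional part. Merging them into
  -- one index lets orbit points be compared through inequalities of naturals.
  Located : (ℕ → Bool) → ℕ → Set
  Located b i = ∃ λ k → ∃ λ r → b r ≡ true ×
    fromℚ (grid (k ℕ.* D ℕ.+ r)) ≤ ξ * fromℚ t ^ i × ξ * fromℚ t ^ i < fromℚ (grid (suc (k ℕ.* D ℕ.+ r)))

  locate : ∀ b → 0ℝ < ξ → (∀ i → FracIn (⋃ (cells b D)) (ξ * fromℚ t ^ i)) → ∀ i → Located b i
  locate b ξ>0 h i = let n , floor , x∈ = h i in at (floor-nonNeg ξ>0 i {n} floor) x∈
    where
    grid-int′ : ∀ k r → grid (k ℕ.* D ℕ.+ r) ≡ (+ k ℚ./ 1) ℚ.+ grid r
    grid-int′ k r = trans (grid-int k r) (cong (ℚ._+ grid r) (sym (ι-def k)))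
    at : ∀ {n} → (∃ λ k → n ≡ + k) → ξ * fromℚ t ^ i - fromℤ n ∈ ⋃ (cells b D) → Located b i
    at (k , refl) x∈ =
      let r , _ , br , r≤x , x<1+r = ∈-cells b D x∈
      in k , r , br ,
        (λ x<r → r≤x (sub-< {ξ * fromℚ t ^ i} {+ k} {grid r}
          (subst (λ g → ξ * fromℚ t ^ i < fromℚ g) (grid-int′ k r) x<r))) ,
        subst (λ g → ξ * fromℚ t ^ i < fromℚ g)
          (trans (sym (grid-int′ k (suc r))) (cong grid (ℕ.+-suc (k ℕ.* D) r)))
          (add-< {ξ * fromℚ t ^ i} {+ k} {grid (suc r)} x<1+r)

-- Assembling the family of intervals and choosing the parameters.

LongFamily : ℝ → (Pred ℝ 0ℓ → Set) → Set
LongFamily ε R = Σ (List Interval) λ Is →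
  PairwiseDisjoint Is × ⋃ Is ⊆ [0,1⟩ × 1ℝ - ε ≤ totalLength Is × R (⋃ Is)

Avoided : ℚ → Pred ℝ 0ℓ → Set
Avoided t S = ∀ ξ → 0ℝ < ξ → ¬ (∀ i → FracIn S (ξ * fromℚ t ^ i))

module Avoiding (P Q N : ℕ) {{P≢0 : NonZero P}} {{Q≢0 : NonZero Q}} where

  open Cells P Q N public

  instance
    D≢0 : NonZero D
    D≢0 = ℕ.m*n≢0 (Q ℕ.^ suc N) (P ℕ.^ N) {{ℕ.m^n≢0 Q (suc N)}} {{ℕ.m^n≢0 P N}}

  open Grid D

  good : ℕ → Bool
  good r = not (bad r)

  not-true : ∀ {b} → not b ≡ true → b ≡ false
  not-true {false} _ = refl

  length-bound : ∀ M {{_ : NonZero M}} → M ℕ.* ∑ D (λ r → 𝟙 (bad r)) ℕ.≤ 2 ℕ.* D →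
    ∀ δ → ι 2 ℚ.≤ ι M ℚ.* δ → ∀ m → 1ℚ ℚ.≤ δ ℚ.+ seq (totalLength (cells good D)) m
  length-bound M few δ 2≤Mδ m = begin
    1ℚ                                               ≡⟨ grid-D ⟨
    grid D                                           ≡⟨ cong grid (count-not D bad) ⟨
    grid (#good ℕ.+ #bad)                            ≡⟨ grid-+ #good #bad ⟩
    grid #good ℚ.+ grid #bad                         ≡⟨ ℚ.+-comm (grid #good) (grid #bad) ⟩
    grid #bad ℚ.+ grid #good                         ≤⟨ ℚ.+-monoˡ-≤ (grid #good) bad≤δ ⟩
    δ ℚ.+ grid #good                                 ≡⟨ cong (δ ℚ.+_) (cells-length good D m) ⟨
    δ ℚ.+ seq (totalLength (cells good D)) m         ∎
    where
    open ℚ.≤-Reasoning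
    #good #bad : ℕ
    #good = ∑ D (λ r → 𝟙 (good r))
    #bad  = ∑ D (λ r → 𝟙 (bad r))
    bad≤δ : grid #bad ℚ.≤ δ
    bad≤δ = ℚ.*-cancelˡ-≤-pos (ι M) {{ι-pos M}} (begin
      ι M ℚ.* grid #bad    ≡⟨ grid-* M #bad ⟨
      grid (M ℕ.* #bad)    ≤⟨ grid-mono-≤ few ⟩
      grid (2 ℕ.* D)       ≡⟨ grid-* 2 D ⟩
      ι 2 ℚ.* grid D       ≡⟨ cong (ι 2 ℚ.*_) grid-D ⟩
      ι 2 ℚ.* 1ℚ           ≡⟨ ℚ.*-identityʳ (ι 2) ⟩
      ι 2                  ≤⟨ 2≤Mδ ⟩
      ι M ℚ.* δ            ∎)

  -- The witness δ₀ of 0 < ε bounds the terms of ε from below eventually, and the bad cells have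
  -- total length at most 2/M ≤ δ₀. A gap below 1 - ε is refuted at an index past both thresholds.
  total-length : ∀ M {{_ : NonZero M}} → M ℕ.* ∑ D (λ r → 𝟙 (bad r)) ℕ.≤ 2 ℕ.* D →
    ∀ ε (ε>0 : 0ℝ < ε) → ι 2 ℚ.≤ ι M ℚ.* proj₁ ε>0 → 1ℝ - ε ≤ totalLength (cells good D)
  total-length M few ε (δ₀ , _ , K₀ , h₀) 2≤Mδ₀ (δ , δ>0 , K , h) =
    p+δ≰q δ>0 (p≤q+r⇒p-q≤r 1ℚ (seq ε m) total (begin
      1ℚ                     ≤⟨ length-bound M few δ₀ 2≤Mδ₀ m ⟩
      δ₀ ℚ.+ total           ≡⟨ cong (ℚ._+ total) (ℚ.+-identityˡ δ₀) ⟨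
      0ℚ ℚ.+ δ₀ ℚ.+ total    ≤⟨ ℚ.+-monoˡ-≤ total (h₀ m (ℕ.m≤m⊔n K₀ K)) ⟩
      seq ε m ℚ.+ total      ∎)) (h m (ℕ.m≤n⊔m K₀ K))
    where
    open ℚ.≤-Reasoning
    m : ℕ
    m = K₀ ℕ.⊔ K
    total : ℚ
    total = seq (totalLength (cells good D)) m

  -- `ratio` states t^(c j) = (P/Q)^j without division; the factor `1ℚ` is `pow t 0`, so it relates
  -- times 0 and c j in `orbit-transfer`.
  module _ (t : ℚ) {{t>0 : ℚ.Positive t}} (c : ℕ)
    (ratio : ∀ j → ι (Q ℕ.^ j) ℚ.* pow t (c ℕ.* j) ≡ ι (P ℕ.^ j) ℚ.* 1ℚ) (ξ : ℝ) where

    open Orbit t D ξ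

    unlocatable : ¬ (∀ i → Located good i)
    unlocatable located = start (located 0)
      where
      start : ¬ Located good 0
      start (k , r , good-r , r≤x₀ , x₀<1+r) = step (proj₂ (good⇒hit r (not-true good-r)))
        where
        step : ¬ ∃ λ j → j ℕ.≤ N × hit j r ≡ true
        step (j , j≤N , hit-j) = clash (located (c ℕ.* j))
          where
          clash : ¬ Located good (c ℕ.* j)
          clash (k′ , r′ , good-r′ , r′≤xⱼ , xⱼ<1+r′) = true≢false
            (trans (sym hit-j) (trans (hit-orbit j≤N k r k′ r′ ¬below ¬above)
              (proj₁ (good⇒hit r′ (not-true good-r′)))))
            where
            true≢false : ¬ (true ≡ false)
            true≢false ()
            -- If the image of the first cell lay wholly below the second, the upper bound on the
            -- point at time 0 would contradict the lower bound at time c j. `¬above` runs the same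
            -- argument backwards in time.
            ¬below : ¬ (P ℕ.^ j ℕ.* suc (k ℕ.* D ℕ.+ r) ℕ.≤ Q ℕ.^ j ℕ.* (k′ ℕ.* D ℕ.+ r′))
            ¬below le = r′≤xⱼ (orbit-transfer (P ℕ.^ j) (Q ℕ.^ j) {{ℕ.m^n≢0 P j}} {{ℕ.m^n≢0 Q j}}
              {0} {c ℕ.* j} (ratio j) le x₀<1+r)
            ¬above : ¬ (Q ℕ.^ j ℕ.* suc (k′ ℕ.* D ℕ.+ r′) ℕ.≤ P ℕ.^ j ℕ.* (k ℕ.* D ℕ.+ r))
            ¬above le = r≤x₀ (orbit-transfer (Q ℕ.^ j) (P ℕ.^ j) {{ℕ.m^n≢0 Q j}} {{ℕ.m^n≢0 P j}}
              {c ℕ.* j} {0} (sym (ratio j)) le xⱼ<1+r′)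

    good-avoided : 0ℝ < ξ → ¬ (∀ i → FracIn (⋃ (cells good D)) (ξ * fromℚ t ^ i))
    good-avoided ξ>0 frac = unlocatable (locate good ξ>0 frac)

  good-family : ∀ t {{_ : ℚ.Positive t}} c →
    (∀ j → ι (Q ℕ.^ j) ℚ.* pow t (c ℕ.* j) ≡ ι (P ℕ.^ j) ℚ.* 1ℚ) →
    ∀ M {{_ : NonZero M}} → Coprime P Q → M ℕ.< Q → suc N ≡ M ℕ.* ℕ.pred Q →
    ∀ ε (ε>0 : 0ℝ < ε) → ι 2 ℚ.≤ ι M ℚ.* proj₁ ε>0 → LongFamily ε (Avoided t)
  good-family t c ratio M P⊥Q M<Q suc-N ε ε>0 2≤Mδ =
    cells good D , cells-disjoint good D , (λ {x} → cells⊆[0,1⟩ good {x}) ,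
    total-length M (few-bad M {{ℕ.>-nonZero pred-Q>0}} P⊥Q (ℕ.<⇒≤ M<Q) suc-N) ε ε>0 2≤Mδ ,
    good-avoided t c ratio
    where
    pred-Q>0 : 0 ℕ.< ℕ.pred Q
    pred-Q>0 = ℕ.<-≤-trans (ℕ.>-nonZero⁻¹ M) (ℕ.<⇒≤pred M<Q)

-- M is chosen with 2/M below the rational witness of ε, the 2 counting the two sources of bad
-- cells. Then P = p^M, Q = q^M > M, c = M and N+1 = M (Q-1) meet every requirement.
avoided-family : ∀ {p q} → 1 ℕ.< q → q ℕ.< p → Coprime p q →
  ∀ t {{_ : ℚ.Positive t}} → (∀ i → ι (q ℕ.^ i) ℚ.* pow t i ≡ ι (p ℕ.^ i)) →
  ∀ ε → 0ℝ < ε → LongFamily ε (Avoided t)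
avoided-family {p} {q} 1<q q<p p⊥q t ratio ε ε>0 =
  choose (archimedean 2 (proj₁ ε>0) (proj₁ (proj₂ ε>0)))
  where
  instance
    q≢0 : NonZero q
    q≢0 = ℕ.>-nonZero (ℕ.<-trans ℕ.z<s 1<q)
    p≢0 : NonZero p
    p≢0 = ℕ.>-nonZero (ℕ.<-trans (ℕ.<-trans ℕ.z<s 1<q) q<p)
  choose : (∃ λ M → NonZero M × ι 2 ℚ.≤ ι M ℚ.* proj₁ ε>0) → LongFamily ε (Avoided t)
  choose (M , M≢0 , 2≤Mδ) =
    Avoiding.good-family (p ℕ.^ M) (q ℕ.^ M) (ℕ.pred (M ℕ.* ℕ.pred (q ℕ.^ M)))
      {{ℕ.m^n≢0 p M}} {{ℕ.m^n≢0 q M}} t M power-ratio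
      M {{M≢0}} (coprime-^ M M p⊥q) M<Q suc-N ε ε>0 2≤Mδ
    where
    M<Q : M ℕ.< q ℕ.^ M
    M<Q = k<m^k 1<q M
    suc-N : suc (ℕ.pred (M ℕ.* ℕ.pred (q ℕ.^ M))) ≡ M ℕ.* ℕ.pred (q ℕ.^ M)
    suc-N = ℕ.suc-pred (M ℕ.* ℕ.pred (q ℕ.^ M)) {{ℕ.m*n≢0 M (ℕ.pred (q ℕ.^ M)) {{M≢0}} {{pred-Q≢0}}}}
      where
      pred-Q≢0 : NonZero (ℕ.pred (q ℕ.^ M))
      pred-Q≢0 = ℕ.>-nonZero (ℕ.<-≤-trans (ℕ.>-nonZero⁻¹ M {{M≢0}}) (ℕ.<⇒≤pred M<Q))
    power-ratio : ∀ j → ι ((q ℕ.^ M) ℕ.^ j) ℚ.* pow t (M ℕ.* j) ≡ ι ((p ℕ.^ M) ℕ.^ j) ℚ.* 1ℚ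
    power-ratio j = begin
      ι ((q ℕ.^ M) ℕ.^ j) ℚ.* pow t (M ℕ.* j)    ≡⟨ cong (λ a → ι a ℚ.* pow t (M ℕ.* j)) (ℕ.^-*-assoc q M j) ⟩
      ι (q ℕ.^ (M ℕ.* j)) ℚ.* pow t (M ℕ.* j)    ≡⟨ ratio (M ℕ.* j) ⟩
      ι (p ℕ.^ (M ℕ.* j))                        ≡⟨ cong ι (ℕ.^-*-assoc p M j) ⟨
      ι ((p ℕ.^ M) ℕ.^ j)                        ≡⟨ ℚ.*-identityʳ _ ⟨
      ι ((p ℕ.^ M) ℕ.^ j) ℚ.* 1ℚ                 ∎
      where open ≡-Reasoning

Avoided⇒Z-empty : ∀ p q .{{_ : NonZero q}} ε →
  LongFamily ε (Avoided (+ p ℚ./ q)) → LongFamily ε (λ S → Empty (Z p q S))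
Avoided⇒Z-empty p q ε (Is , disjoint , within , long , avoided) =
  Is , disjoint , (λ {x} → within {x}) , long , empty
  where
  empty : Empty (Z p q (⋃ Is))
  empty ξ (ξ>0 , frac) = avoided ξ ξ>0 frac

theorem4 : (p q : ℕ) .{{_ : NonZero q}} → 1 ℕ.< q → q ℕ.< p → Coprime p q →
    (ε : ℝ) → 0ℝ < ε →
    Σ (List Interval) λ Is →
    PairwiseDisjoint Is ×
    ⋃ Is ⊆ [0,1⟩ ×
    1ℝ - ε ≤ totalLength Is ×
    Empty (Z p q (⋃ Is))
-- The instance is passed explicitly because an unsolved instance argument makes
-- the conversion checker unfold the Cauchy proofs inside the reals.
theorem4 p q {{q≢0}} 1<q q<p p⊥q ε ε>0 = Avoided⇒Z-empty p q {{q≢0}} ε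
  (avoided-family 1<q q<p p⊥q ((+ p ℚ./ q) {{q≢0}}) {{p/q>0}} (ι-pow p q {{q≢0}}) ε ε>0)
  where
  p/q>0 : ℚ.Positive ((+ p ℚ./ q) {{q≢0}})
  p/q>0 = ℚ.normalize-pos p q {{q≢0}} {{ℕ.>-nonZero (ℕ.<-trans (ℕ.<-trans ℕ.z<s 1<q) q<p)}}
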